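{- Let $n\ge 1$ and $1\le j\le n$. The number of weakly-decreasing parking functions of $1,\ldots,n$ for which the $j$-th spot is lucky, and likewise the number for which the $j$-th car is lucky, is \[ \sum_{k=0}^{n-j}C_{n-1-k}C_k=\sum_{k=0}^{n-j}\frac1{(n-k)(k+1)}\binom{2(n-1-k)}{n-1-k}\binom{2k}{k}. \]
   Context: There are $n$ spots labeled $1,\ldots,n$ in order along a one-way street, and $n$ cars entering one after another, car $i$ having preference $a_i\in\{1,\ldots,n\}$. Each car drives to its preferred spot and parks there if it is available; otherwise it moves forward and parks in the first available later spot, if any (if none, it fails to park). A parking function of $1,\ldots,n$ is a sequence of preferences $(a_1,\ldots,a_n)$ such that all $n$ cars are able to park; it is weakly-decreasing if $a_1\ge a_2\ge\cdots\ge a_n$. A car is lucky if it parks in its preferred spot; a spot is lucky if the car that parks in it prefers that spot. $C_m=\frac1{m+1}\binom{2m}{m}$ is the $m$-th Catalan number. -}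

module Defs where

open import Data.Fin.Base as Fin using (Fin; toℕ)
import Data.Fin.Properties as Finₚ
open import Data.Fin.Subset using (Subset; _∪_; ⁅_⁆) renaming (⊥ to ∅)
open import Data.Fin.Subset.Properties using (_∈?_)
open import Data.Integer.Base using (+_)
open import Data.List.Base using (find; allFin; length)
open import Data.List.Membership.Propositional using (_∈_)
open import Data.List.Relation.Unary.Unique.Propositional using (Unique)
open import Data.Maybe using (Maybe; just; nothing; Is-just)
open import Data.Nat.Base as ℕ using (ℕ; suc; NonZero)
open import Data.Nat.Combinatorics using (_C_)
import Data.Nat.Properties as ℕₚ
open import Data.Product.Base using (_×_; ∃-syntax)
open import Data.Rational.Base using (ℚ; _/_; _*_)
open import Data.Rational.Properties using (+-0-monoid)
open import Data.Vec.Base using (Vec; []; _∷_; lookup)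
open import Data.Vec.Relation.Unary.Linked using (Linked)
open import Function.Bundles using (_⇔_)
open import Relation.Binary.PropositionalEquality.Core using (_≡_)
open import Relation.Nullary.Decidable.Core using (_×-dec_; ¬?)

open import Algebra.Properties.Monoid.Sum +-0-monoid public using (sum⁺-syntax)

-- Spots and cars are elements of Fin n; the one labelled 1, …, n in the usual
-- convention is the one whose label is given here.
label : ∀ {n} → Fin n → ℕ
label i = suc (toℕ i)

Preferences : ℕ → Set
Preferences n = Vec (Fin n) n

-- allFin lists the spots in street order, so find returns the first spot that
-- is unoccupied and not before the preferred one.
firstAvailable : ∀ {n} → Subset n → Fin n → Maybe (Fin n)
firstAvailable {n} occupied p =
  find (λ s → (p Finₚ.≤? s) ×-dec ¬? (s ∈? occupied)) (allFin n)

occupy : ∀ {n} → Maybe (Fin n) → Subset n → Subset n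
occupy nothing  occupied = occupied
occupy (just s) occupied = occupied ∪ ⁅ s ⁆

-- The entry for a car is nothing when that car fails to park.
park : ∀ {n m} → Subset n → Vec (Fin n) m → Vec (Maybe (Fin n)) m
park occupied []       = []
park occupied (p ∷ ps) = s ∷ park (occupy s occupied) ps
  where s = firstAvailable occupied p

outcome : ∀ {n} → Preferences n → Vec (Maybe (Fin n)) n
outcome = park ∅

IsParkingFunction : ∀ {n} → Preferences n → Set
IsParkingFunction a = ∀ i → Is-just (lookup (outcome a) i)

IsWeaklyDecreasing : ∀ {n} → Preferences n → Set
IsWeaklyDecreasing = Linked Fin._≥_

LuckyCar : ∀ {n} → Fin n → Preferences n → Set
LuckyCar i a = lookup (outcome a) i ≡ just (lookup a i)

LuckySpot : ∀ {n} → Fin n → Preferences n → Set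
LuckySpot s a = ∃[ i ] lookup (outcome a) i ≡ just s × lookup a i ≡ s

infix 4 _HasSize_

_HasSize_ : {A : Set} → (A → Set) → ℕ → Set
_HasSize_ {A} P N =
  ∃[ xs ] Unique xs × (∀ (x : A) → x ∈ xs ⇔ P x) × length xs ≡ N

ℕ→ℚ : ℕ → ℚ
ℕ→ℚ m = + m / 1

-- Taken in ℚ so that the division is exact by definition.
catalan : ℕ → ℚ
catalan m = + 1 / suc m * ℕ→ℚ ((2 ℕ.* m) C m)

-- The denominator (n - k)(k + 1) does not vanish for 0 ≤ k ≤ n - j.
denominator-nonZero : ∀ {n} (j : Fin n) (k : Fin (suc (n ℕ.∸ label j))) →
                      NonZero ((n ℕ.∸ toℕ k) ℕ.* suc (toℕ k))
denominator-nonZero {n} j k = ℕₚ.m*n≢0 _ _ {{ℕ.>-nonZero (ℕₚ.m<n⇒0<n∸m k<n)}}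
  where
  k<n : toℕ k ℕ.< n
  k<n = ℕₚ.<-≤-trans (Finₚ.toℕ<n k)
          (ℕₚ.∸-monoʳ-< {n} {label j} {0} (ℕ.s≤s ℕ.z≤n) (Finₚ.toℕ<n j))

recipDenominator : ∀ {n} (j : Fin n) → Fin (suc (n ℕ.∸ label j)) → ℚ
recipDenominator {n} j k =
  (+ 1 / ((n ℕ.∸ toℕ k) ℕ.* suc (toℕ k))) {{denominator-nonZero j k}}

{-# OPTIONS --safe #-}
module Submission where

-- Read a weakly decreasing parking function as a lattice path that lowers the
-- current spot (up-step) or sends in a car preferring it (down-step); it stays
-- at or above 0 exactly when all cars park.  A car is lucky iff it is the first one to
-- prefer its spot, so a spot is lucky iff its up-step is followed by a
-- down-step, and a car is lucky iff its down-step is preceded by an up-step.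
-- Conditioning on the first step of a path that starts at an arbitrary height d
-- gives recurrences in the numbers of remaining up- and down-steps.  They are
-- solved by convolutions of ballot numbers with Catalan numbers, because such a
-- convolution satisfies the ballot recurrence termwise; d = 0 is the theorem.

open import Data.Empty using (⊥-elim)
open import Data.Fin.Base as Fin using (Fin; zero; suc; toℕ; fromℕ; fromℕ<; inject₁)
import Data.Fin.Properties as Fin
open import Data.Fin.Subset as Subset using (Subset; ⁅_⁆; _∪_; ∣_∣; inside; outside)
  renaming (_∈_ to _∈ˢ_; _∉_ to _∉ˢ_)
import Data.Fin.Subset.Properties as Subset
open import Data.Integer.Base as ℤ using () renaming (+_ to pos)
import Data.Integer.Properties as ℤ
open import Data.List.Base using ([]; _∷_; _++_; map; find; allFin)
open import Data.List.Membership.Propositional using (_∈_)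
open import Data.List.Membership.Propositional.Properties
  using (∈-map⁺; ∈-map⁻; ∈-++⁺ˡ; ∈-++⁺ʳ; ∈-++⁻; ∈-allFin)
import Data.List.Properties as List
open import Data.List.Relation.Unary.All as All using ([])
open import Data.List.Relation.Unary.AllPairs using (AllPairs; []; _∷_)
import Data.List.Relation.Unary.AllPairs.Properties as AllPairs
open import Data.List.Relation.Unary.Any using (here; there)
import Data.List.Relation.Unary.Unique.Propositional.Properties as Unique
open import Data.Maybe using (just; nothing; Is-just)
import Data.Maybe.Relation.Unary.Any as Maybe
open import Data.Nat.Base using (ℕ; zero; suc; _+_; _∸_; _≤_; _<_; z≤n; s≤s; NonZero) renaming (_*_ to _*ℕ_)
open import Data.Nat.Combinatorics using (_C_; nCk≡nC[n∸k]; nCk+nC[k+1]≡[n+1]C[k+1]; nC1≡n)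
import Data.Nat.Properties as ℕ
open import Data.Nat.Tactic.RingSolver using (solve-∀)
open import Data.Product.Base using (_×_; _,_; ∃-syntax; proj₁; proj₂; map₂)
open import Data.Rational.Base as ℚ using (ℚ; _*_; _/_)
import Data.Rational.Properties as ℚ
open import Data.Rational.Unnormalised.Base as ℚᵘ using (mkℚᵘ; *≡*)
import Data.Rational.Unnormalised.Properties as ℚᵘ
open import Data.Sum.Base as Sum using (_⊎_; inj₁; inj₂; [_,_]′)
open import Data.Unit.Base using (⊤; tt)
open import Data.Vec.Base using (Vec; []; _∷_; lookup; here; there)
open import Data.Vec.Membership.Propositional using () renaming (_∈_ to _∈ᵛ_)
open import Data.Vec.Membership.Propositional.Properties using (∈-lookup)
import Data.Vec.Properties as Vec
open import Data.Vec.Relation.Unary.Any using (here; there)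
open import Data.Vec.Relation.Unary.Linked using (Linked; []; [-]; _∷_)
open import Function.Base using (_∘_; id)
open import Function.Bundles using (_⇔_; mk⇔; Equivalence)
open import Relation.Binary.PropositionalEquality
  using (_≡_; _≢_; refl; sym; trans; cong; cong₂; subst; module ≡-Reasoning)
open import Relation.Nullary using (¬_; yes; no; contradiction)
open import Relation.Nullary.Decidable using (decidable-stable)
open import Relation.Unary using (Decidable)
open import Defs

open import Algebra.Properties.Monoid.Sum ℚ.+-0-monoid using (sum-cong-≗; sum-init-last; sum-syntax)
open import Algebra.Properties.CommutativeSemigroup ℕ.+-commutativeSemigroup using (interchange)
open Equivalence using (to; from)

-- Ballot numbers and their closed form

-- Lattice paths that start at height d, take p up-steps and d + p down-steps,
-- and never go below height 0; the equations condition on the first step.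
ballot : ℕ → ℕ → ℕ
ballot zero    d       = 1
ballot (suc p) zero    = ballot p 1
ballot (suc p) (suc d) = ballot p (suc (suc d)) + ballot (suc p) d

infixl 6.5 _C⁻_

-- Stands for `n C (k - 1)`. Truncated subtraction would give `n C 0 = 1` at `k = 0`, where the
-- reflection principle needs 0.
_C⁻_ : ℕ → ℕ → ℕ
n C⁻ zero  = 0
n C⁻ suc k = n C k

pascal⁻ : ∀ n k → n C⁻ k + n C k ≡ suc n C k
pascal⁻ n zero    = refl
pascal⁻ n (suc k) = nCk+nC[k+1]≡[n+1]C[k+1] n k

-- Reflection principle.
ballot-reflection : ∀ p d → ballot p d + (d + (p + p)) C⁻ p ≡ (d + (p + p)) C p
ballot-reflection zero    d    = refl
ballot-reflection (suc p) zero rewrite ℕ.+-suc p p = begin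
  ballot p 1 + N₂ C p                        ≡⟨ cong (ballot p 1 +_) (pascal⁻ N₁ p) ⟨
  ballot p 1 + (N₁ C⁻ p + N₁ C p)            ≡⟨ ℕ.+-assoc (ballot p 1) _ _ ⟨
  ballot p 1 + N₁ C⁻ p + N₁ C p              ≡⟨ cong (_+ N₁ C p) (ballot-reflection p 1) ⟩
  N₁ C p + N₁ C p                            ≡⟨ cong ((N₁ C p) +_) symmetric ⟩
  N₁ C p + N₁ C suc p                        ≡⟨ nCk+nC[k+1]≡[n+1]C[k+1] N₁ p ⟩
  N₂ C suc p                                 ∎
  where
  open ≡-Reasoning
  N₁ = suc (p + p)
  N₂ = suc N₁
  -- `N₁ = 2p + 1` is odd, so its two middle coefficients agree; this makes up for the missing
  -- down-step at height 0.
  symmetric : N₁ C p ≡ N₁ C suc p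
  symmetric = trans (nCk≡nC[n∸k] (ℕ.m≤n⇒m≤1+n (ℕ.m≤m+n p p)))
                    (cong (N₁ C_) (ℕ.m+n∸n≡m (suc p) p))
ballot-reflection (suc p) (suc d) = begin
  b₁ + b₂ + suc N C p              ≡⟨ cong (b₁ + b₂ +_) (pascal⁻ N p) ⟨
  b₁ + b₂ + (N C⁻ p + N C p)       ≡⟨ interchange b₁ b₂ (N C⁻ p) (N C p) ⟩
  (b₁ + N C⁻ p) + (b₂ + N C p)     ≡⟨ cong₂ _+_ up (ballot-reflection (suc p) d) ⟩
  N C p + N C suc p                ≡⟨ nCk+nC[k+1]≡[n+1]C[k+1] N p ⟩
  suc N C suc p                    ∎
  where
  open ≡-Reasoning
  b₁ = ballot p (suc (suc d))
  b₂ = ballot (suc p) d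
  N = d + suc (p + suc p)
  shift : ∀ d p → suc (suc d) + (p + p) ≡ d + suc (p + suc p)
  shift = solve-∀
  up : b₁ + N C⁻ p ≡ N C p
  up = subst (λ m → b₁ + m C⁻ p ≡ m C p) (shift d p) (ballot-reflection p (suc (suc d)))

C-absorption : ∀ n k → suc k *ℕ (suc n C suc k) ≡ suc n *ℕ (n C k)
C-absorption n zero = begin
  1 *ℕ (suc n C 1)  ≡⟨ ℕ.*-identityˡ _ ⟩
  suc n C 1         ≡⟨ nC1≡n (suc n) ⟩
  suc n             ≡⟨ ℕ.*-identityʳ (suc n) ⟨
  suc n *ℕ 1        ∎
  where open ≡-Reasoning
C-absorption zero (suc k) = ℕ.*-zeroʳ (suc (suc k))
C-absorption (suc n) (suc k) = begin
  suc (suc k) *ℕ (suc (suc n) C suc (suc k))           ≡⟨ cong (suc (suc k) *ℕ_) (pascal⁻ (suc n) (suc (suc k))) ⟨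
  suc (suc k) *ℕ (a + b)                               ≡⟨ expand (suc k) a b ⟩
  a + (suc k *ℕ a + suc (suc k) *ℕ b)                  ≡⟨ cong (a +_) (cong₂ _+_ (C-absorption n k) (C-absorption n (suc k))) ⟩
  a + (suc n *ℕ (n C k) + suc n *ℕ (n C suc k))        ≡⟨ cong (a +_) (ℕ.*-distribˡ-+ (suc n) (n C k) (n C suc k)) ⟨
  a + suc n *ℕ (n C k + n C suc k)                     ≡⟨ cong (λ t → a + suc n *ℕ t) (pascal⁻ n (suc k)) ⟩
  suc (suc n) *ℕ a                                     ∎
  where
  open ≡-Reasoning
  a = suc n C suc k
  b = suc n C suc (suc k)
  expand : ∀ k a b → suc k *ℕ (a + b) ≡ a + (k *ℕ a + suc k *ℕ b)
  expand = solve-∀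

-- Ratio of consecutive binomial coefficients with denominators cleared; adding `suc k *ℕ (N C k)`
-- to both sides reduces it to absorption.
C⁻-ratio : ∀ k j → suc j *ℕ ((k + j) C⁻ k) ≡ k *ℕ ((k + j) C k)
C⁻-ratio zero    j = ℕ.*-zeroʳ (suc j)
C⁻-ratio (suc k) j = ℕ.+-cancelˡ-≡ (suc k *ℕ (N C k)) _ _ (begin
  suc k *ℕ (N C k) + suc j *ℕ (N C k)             ≡⟨ collect k j (N C k) ⟩
  suc N *ℕ (N C k)                                ≡⟨ C-absorption N k ⟨
  suc k *ℕ (suc N C suc k)                        ≡⟨ cong (suc k *ℕ_) (pascal⁻ N (suc k)) ⟨
  suc k *ℕ (N C k + N C suc k)                    ≡⟨ ℕ.*-distribˡ-+ (suc k) (N C k) (N C suc k) ⟩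
  suc k *ℕ (N C k) + suc k *ℕ (N C suc k)         ∎)
  where
  open ≡-Reasoning
  N = suc k + j
  collect : ∀ k j x → suc k *ℕ x + suc j *ℕ x ≡ suc (suc k + j) *ℕ x
  collect = solve-∀

-- Reflection at height 0 gives the central coefficient minus its neighbour, and by `C⁻-ratio` the
-- neighbour is `m / (m + 1)` times the central one.
ballot-catalan : ∀ m → suc m *ℕ ballot m 0 ≡ (2 *ℕ m) C m
ballot-catalan m rewrite ℕ.+-identityʳ m = ℕ.+-cancelʳ-≡ (m *ℕ c) _ _ (begin
  suc m *ℕ ballot m 0 + m *ℕ c                       ≡⟨ cong (suc m *ℕ ballot m 0 +_) (C⁻-ratio m m) ⟨
  suc m *ℕ ballot m 0 + suc m *ℕ ((m + m) C⁻ m)      ≡⟨ ℕ.*-distribˡ-+ (suc m) (ballot m 0) _ ⟨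
  suc m *ℕ (ballot m 0 + (m + m) C⁻ m)               ≡⟨ cong (suc m *ℕ_) (ballot-reflection m 0) ⟩
  c + m *ℕ c                                         ∎)
  where
  open ≡-Reasoning
  c = (m + m) C m

-- Transfer to the rationals

toℚᵘ-/ : ∀ i a .{{_ : NonZero a}} → ℚ.toℚᵘ (i / a) ℚᵘ.≃ (i ℚᵘ./ a)
toℚᵘ-/ i (suc a) = ℚ.toℚᵘ-fromℚᵘ (mkℚᵘ i a)

/-≃ : ∀ i j a b .{{_ : NonZero a}} .{{_ : NonZero b}} → i ℤ.* pos b ≡ j ℤ.* pos a → i / a ≡ j / b
/-≃ i j (suc a) (suc b) eq = ℚ.fromℚᵘ-cong {mkℚᵘ i a} {mkℚᵘ j b} (*≡* eq)

*-/ : ∀ i j a b .{{_ : NonZero a}} .{{_ : NonZero b}} .{{_ : NonZero (a *ℕ b)}} →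
      (i / a) * (j / b) ≡ (i ℤ.* j) / (a *ℕ b)
*-/ i j a@(suc _) b@(suc _) = ℚ.toℚᵘ-injective (begin
  ℚ.toℚᵘ ((i / a) * (j / b))           ≈⟨ ℚ.toℚᵘ-homo-* (i / a) (j / b) ⟩
  ℚ.toℚᵘ (i / a) ℚᵘ.* ℚ.toℚᵘ (j / b)   ≈⟨ ℚᵘ.*-cong (toℚᵘ-/ i a) (toℚᵘ-/ j b) ⟩
  (i ℚᵘ./ a) ℚᵘ.* (j ℚᵘ./ b)           ≡⟨⟩
  (i ℤ.* j) ℚᵘ./ (a *ℕ b)              ≈⟨ toℚᵘ-/ (i ℤ.* j) (a *ℕ b) ⟨
  ℚ.toℚᵘ ((i ℤ.* j) / (a *ℕ b))        ∎)
  where open ℚᵘ.≃-Reasoning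

ℕ→ℚ-+ : ∀ a b → ℕ→ℚ (a + b) ≡ ℕ→ℚ a ℚ.+ ℕ→ℚ b
ℕ→ℚ-+ a b = ℚ.toℚᵘ-injective (begin
  ℚ.toℚᵘ (ℕ→ℚ (a + b))                ≈⟨ toℚᵘ-/ (pos (a + b)) 1 ⟩
  mkℚᵘ (pos (a + b)) 0                ≈⟨ *≡* (cong (ℤ._* pos 1) (cong₂ ℤ._+_ (ℤ.*-identityʳ (pos a)) (ℤ.*-identityʳ (pos b)))) ⟨
  mkℚᵘ (pos a) 0 ℚᵘ.+ mkℚᵘ (pos b) 0  ≈⟨ ℚᵘ.+-cong (toℚᵘ-/ (pos a) 1) (toℚᵘ-/ (pos b) 1) ⟨
  ℚ.toℚᵘ (ℕ→ℚ a) ℚᵘ.+ ℚ.toℚᵘ (ℕ→ℚ b)  ≈⟨ ℚ.toℚᵘ-homo-+ (ℕ→ℚ a) (ℕ→ℚ b) ⟨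
  ℚ.toℚᵘ (ℕ→ℚ a ℚ.+ ℕ→ℚ b)            ∎)
  where open ℚᵘ.≃-Reasoning

ℕ→ℚ-* : ∀ a b → ℕ→ℚ (a *ℕ b) ≡ ℕ→ℚ a * ℕ→ℚ b
ℕ→ℚ-* a b = sym (trans (*-/ (pos a) (pos b) 1 1) (cong (_/ 1) (sym (ℤ.pos-* a b))))

catalan≡ballot : ∀ m → catalan m ≡ ℕ→ℚ (ballot m 0)
catalan≡ballot m = begin
  (pos 1 / suc m) * ℕ→ℚ c           ≡⟨ *-/ (pos 1) (pos c) (suc m) 1 ⟩
  (pos 1 ℤ.* pos c) / (suc m *ℕ 1)  ≡⟨ /-≃ (pos 1 ℤ.* pos c) (pos (ballot m 0)) (suc m *ℕ 1) 1 cross ⟩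
  ℕ→ℚ (ballot m 0)                  ∎
  where
  open ≡-Reasoning
  c = (2 *ℕ m) C m
  cross : (pos 1 ℤ.* pos c) ℤ.* pos 1 ≡ pos (ballot m 0) ℤ.* pos (suc m *ℕ 1)
  cross = begin
    (pos 1 ℤ.* pos c) ℤ.* pos 1            ≡⟨ ℤ.*-identityʳ _ ⟩
    pos 1 ℤ.* pos c                        ≡⟨ ℤ.*-identityˡ (pos c) ⟩
    pos c                                  ≡⟨ cong pos (ballot-catalan m) ⟨
    pos (suc m *ℕ ballot m 0)              ≡⟨ cong pos (ℕ.*-comm (suc m) (ballot m 0)) ⟩
    pos (ballot m 0 *ℕ suc m)              ≡⟨ ℤ.pos-* (ballot m 0) (suc m) ⟩
    pos (ballot m 0) ℤ.* pos (suc m)       ≡⟨ cong (λ t → pos (ballot m 0) ℤ.* pos t) (ℕ.*-identityʳ (suc m)) ⟨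
    pos (ballot m 0) ℤ.* pos (suc m *ℕ 1)  ∎

-- Convolutions of ballot numbers

-- Sum over `k < p` of `ballot (p - 1 - k) d` times `g k`.
conv : (ℕ → ℕ) → ℕ → ℕ → ℕ
conv g zero    d = 0
conv g (suc p) d = ballot p d *ℕ g 0 + conv (g ∘ suc) p d

-- The terms `k < p` follow the ballot recurrence at height 0; the last one, `ballot 0 0 *ℕ g p`, is
-- left over as a boundary term.
conv-0 : ∀ g p → conv g (suc p) 0 ≡ conv g p 1 + g p
conv-0 g zero    = trans (ℕ.+-identityʳ _) (ℕ.*-identityˡ (g 0))
conv-0 g (suc p) = trans (cong (ballot p 1 *ℕ g 0 +_) (conv-0 (g ∘ suc) p))
        (sym (ℕ.+-assoc (ballot p 1 *ℕ g 0) (conv (g ∘ suc) p 1) (g (suc p))))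

-- The ballot recurrence holds term by term. The last term has no up-steps left and occurs only in
-- the down-step summand, unchanged because `ballot 0` is constant.
conv-suc : ∀ g p d → conv g (suc p) (suc d) ≡ conv g p (suc (suc d)) + conv g (suc p) d
conv-suc g zero    d = refl
conv-suc g (suc p) d = begin
  (b₁ + b₂) *ℕ g 0 + conv (g ∘ suc) (suc p) (suc d)  ≡⟨ cong ((b₁ + b₂) *ℕ g 0 +_) (conv-suc (g ∘ suc) p d) ⟩
  (b₁ + b₂) *ℕ g 0 + (s + t)                         ≡⟨ regroup b₁ b₂ (g 0) s t ⟩
  (b₁ *ℕ g 0 + s) + (b₂ *ℕ g 0 + t)                  ∎
  where
  open ≡-Reasoning
  b₁ = ballot p (suc (suc d))
  b₂ = ballot (suc p) d
  s = conv (g ∘ suc) p (suc (suc d))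
  t = conv (g ∘ suc) (suc p) d
  regroup : ∀ a b c s t → (a + b) *ℕ c + (s + t) ≡ (a *ℕ c + s) + (b *ℕ c + t)
  regroup = solve-∀

conv-cong : ∀ {g h} p d → (∀ k → k < p → g k ≡ h k) → conv g p d ≡ conv h p d
conv-cong zero    d g≡h = refl
conv-cong (suc p) d g≡h =
  cong₂ _+_ (cong (ballot p d *ℕ_) (g≡h 0 (s≤s z≤n))) (conv-cong p d λ k k<p → g≡h (suc k) (s≤s k<p))

conv-vanish : ∀ {g} p d → (∀ k → g k ≡ 0) → conv g p d ≡ 0
conv-vanish zero    d g≡0 = refl
conv-vanish (suc p) d g≡0 =
  cong₂ _+_ (trans (cong (ballot p d *ℕ_) (g≡0 0)) (ℕ.*-zeroʳ (ballot p d))) (conv-vanish p d (g≡0 ∘ suc))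

-- Decomposition at the first visit to height 0: before its last step the path from `suc d` stays at
-- or above 1, and afterwards it is a path from 0 to 0 with `k` up-steps. The proof only checks that
-- both sides satisfy the same recurrence.
conv-catalan : ∀ p d → conv (λ k → ballot k 0) (suc p) d ≡ ballot p (suc d)
conv-catalan zero    zero    = refl
conv-catalan (suc p) zero    =
  trans (conv-0 (λ k → ballot k 0) (suc p)) (cong (_+ ballot p 1) (conv-catalan p 1))
conv-catalan zero    (suc d) =
  trans (conv-suc (λ k → ballot k 0) zero d) (conv-catalan zero d)
conv-catalan (suc p) (suc d) =
  trans (conv-suc (λ k → ballot k 0) (suc p) d)
        (cong₂ _+_ (conv-catalan p (suc (suc d))) (conv-catalan (suc p) d))

-- The bound `r` itself is kept. Cutting off the weight rather than the sum leaves the recurrences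
-- of `conv` applicable.
truncate : ℕ → (ℕ → ℕ) → ℕ → ℕ
truncate zero    g zero    = g 0
truncate zero    g (suc k) = 0
truncate (suc r) g zero    = g 0
truncate (suc r) g (suc k) = truncate r (g ∘ suc) k

truncate-≤ : ∀ {r k} g → k ≤ r → truncate r g k ≡ g k
truncate-≤ {zero}  g z≤n       = refl
truncate-≤ {suc r} g z≤n       = refl
truncate-≤ {suc r} g (s≤s k≤r) = truncate-≤ (g ∘ suc) k≤r

truncate-> : ∀ {r k} g → r < k → truncate r g k ≡ 0
truncate-> {zero}  g (s≤s _)   = refl
truncate-> {suc r} g (s≤s r<k) = truncate-> (g ∘ suc) r<k

conv-truncate-∑ : ∀ r g p d → r < p →
  ℕ→ℚ (conv (truncate r g) p d) ≡ ∑[ k ≤ r ] (ℕ→ℚ (ballot (p ∸ suc (toℕ k)) d) * ℕ→ℚ (g (toℕ k)))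
conv-truncate-∑ zero    g (suc p) d _ = begin
  ℕ→ℚ (ballot p d *ℕ g 0 + conv (λ _ → 0) p d)   ≡⟨ cong (λ t → ℕ→ℚ (ballot p d *ℕ g 0 + t)) (conv-vanish p d (λ _ → refl)) ⟩
  ℕ→ℚ (ballot p d *ℕ g 0 + 0)                    ≡⟨ ℕ→ℚ-+ (ballot p d *ℕ g 0) 0 ⟩
  ℕ→ℚ (ballot p d *ℕ g 0) ℚ.+ ℚ.0ℚ               ≡⟨ cong (ℚ._+ ℚ.0ℚ) (ℕ→ℚ-* (ballot p d) (g 0)) ⟩
  ℕ→ℚ (ballot p d) * ℕ→ℚ (g 0) ℚ.+ ℚ.0ℚ          ∎
  where open ≡-Reasoning
conv-truncate-∑ (suc r) g (suc p) d (s≤s r<p) =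
  trans (ℕ→ℚ-+ (ballot p d *ℕ g 0) (conv (truncate r (g ∘ suc)) p d))
        (cong₂ ℚ._+_ (ℕ→ℚ-* (ballot p d) (g 0)) (conv-truncate-∑ r (g ∘ suc) p d r<p))

-- Rational sums

∑-reverse : ∀ n (f : ℕ → ℚ) → ∑[ k < n ] f (toℕ k) ≡ ∑[ k < n ] f (n ∸ suc (toℕ k))
∑-reverse zero    f = refl
∑-reverse (suc n) f = begin
  ∑[ k < suc n ] f (toℕ k)
    ≡⟨ sum-init-last {n} (f ∘ toℕ) ⟩
  ∑[ k < n ] f (toℕ (inject₁ k)) ℚ.+ f (toℕ (fromℕ n))
    ≡⟨ cong₂ ℚ._+_ (sum-cong-≗ {n} λ k → cong f (Fin.toℕ-inject₁ k)) (cong f (Fin.toℕ-fromℕ n)) ⟩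
  ∑[ k < n ] f (toℕ k) ℚ.+ f n
    ≡⟨ ℚ.+-comm (∑[ k < n ] f (toℕ k)) (f n) ⟩
  f n ℚ.+ ∑[ k < n ] f (toℕ k)
    ≡⟨ cong (f n ℚ.+_) (∑-reverse n f) ⟩
  ∑[ k < suc n ] f (n ∸ toℕ k)
    ∎
  where open ≡-Reasoning

recip-split : ∀ {n} (j : Fin n) (k : Fin (suc (n ∸ label j))) →
  catalan (n ∸ 1 ∸ toℕ k) * catalan (toℕ k)
    ≡ recipDenominator j k * ℕ→ℚ ((2 *ℕ (n ∸ 1 ∸ toℕ k)) C (n ∸ 1 ∸ toℕ k)) * ℕ→ℚ ((2 *ℕ toℕ k) C toℕ k)
recip-split {n} j k = begin
  (r₁ * x) * (r₂ * y)   ≡⟨ ℚ.*-assoc r₁ x (r₂ * y) ⟩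
  r₁ * (x * (r₂ * y))   ≡⟨ cong (r₁ *_) (trans (sym (ℚ.*-assoc x r₂ y)) (trans (cong (_* y) (ℚ.*-comm x r₂)) (ℚ.*-assoc r₂ x y))) ⟩
  r₁ * (r₂ * (x * y))   ≡⟨ ℚ.*-assoc r₁ r₂ (x * y) ⟨
  r₁ * r₂ * (x * y)     ≡⟨ cong (_* (x * y)) recip ⟩
  r * (x * y)           ≡⟨ ℚ.*-assoc r x y ⟨
  r * x * y             ∎
  where
  open ≡-Reasoning
  m = n ∸ 1 ∸ toℕ k
  x = ℕ→ℚ ((2 *ℕ m) C m)
  y = ℕ→ℚ ((2 *ℕ toℕ k) C toℕ k)
  r₁ = pos 1 / suc m
  r₂ = pos 1 / suc (toℕ k)
  r = recipDenominator j k
  k<n : toℕ k < n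
  k<n = ℕ.<-≤-trans (Fin.toℕ<n k) (ℕ.∸-monoʳ-< {n} {label j} {0} (s≤s z≤n) (Fin.toℕ<n j))
  -- Subtraction is truncated, so this relies on `k<n`.
  m≡ : suc m ≡ n ∸ toℕ k
  m≡ = trans (cong suc (ℕ.∸-+-assoc n 1 (toℕ k))) (sym (ℕ.+-∸-assoc 1 k<n))
  recip : r₁ * r₂ ≡ r
  recip = trans (*-/ (pos 1) (pos 1) (suc m) (suc (toℕ k)))
    (ℚ./-cong {pos 1} {suc m *ℕ suc (toℕ k)} {{_}} {{denominator-nonZero j k}} refl (cong (_*ℕ suc (toℕ k)) m≡))

-- Counting lattice paths

hasSize-⇔ : ∀ {A : Set} {P Q : A → Set} {N} → (∀ x → P x ⇔ Q x) → P HasSize N → Q HasSize N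
hasSize-⇔ P⇔Q (xs , xs! , ∈⇔P , len) =
  xs , xs! , (λ x → mk⇔ (to (P⇔Q x) ∘ to (∈⇔P x)) (from (∈⇔P x) ∘ from (P⇔Q x))) , len

hasSize-≡ : ∀ {A : Set} {P : A → Set} {M N} → M ≡ N → P HasSize M → P HasSize N
hasSize-≡ refl size = size

hasSize-∅ : ∀ {A : Set} {P : A → Set} → (∀ x → ¬ P x) → P HasSize 0
hasSize-∅ ¬P = [] , [] , (λ x → mk⇔ (λ ()) (⊥-elim ∘ ¬P x)) , refl

hasSize-singleton : ∀ {A : Set} (a : A) → (_≡ a) HasSize 1
hasSize-singleton a = a ∷ [] , [] ∷ [] , (λ x → mk⇔ (λ { (here eq) → eq }) here) , refl

hasSize-⊎ : ∀ {A : Set} {P Q : A → Set} {M N} → (∀ {x} → P x → ¬ Q x) →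
            P HasSize M → Q HasSize N → (λ x → P x ⊎ Q x) HasSize (M + N)
hasSize-⊎ disjoint (xs , xs! , ∈⇔P , lenˣ) (ys , ys! , ∈⇔Q , lenʸ) =
  xs ++ ys ,
  Unique.++⁺ xs! ys! (λ (∈xs , ∈ys) → disjoint (to (∈⇔P _) ∈xs) (to (∈⇔Q _) ∈ys)) ,
  (λ x → mk⇔ (Sum.map (to (∈⇔P x)) (to (∈⇔Q x)) ∘ ∈-++⁻ xs)
             [ ∈-++⁺ˡ ∘ from (∈⇔P x) , ∈-++⁺ʳ xs ∘ from (∈⇔Q x) ]′) ,
  trans (List.length-++ xs) (cong₂ _+_ lenˣ lenʸ)

hasSize-map : ∀ {A B : Set} {P : A → Set} {N} (f : A → B) → (∀ {x y} → f x ≡ f y → x ≡ y) →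
              P HasSize N → (λ y → ∃[ x ] P x × y ≡ f x) HasSize N
hasSize-map f injective (xs , xs! , ∈⇔P , len) =
  map f xs , Unique.map⁺ injective xs! ,
  (λ y → mk⇔ (λ y∈ → let x , x∈ , eq = ∈-map⁻ f y∈ in x , to (∈⇔P x) x∈ , eq)
             (λ { (x , Px , refl) → ∈-map⁺ f (from (∈⇔P x) Px) })) ,
  trans (List.length-map f xs) len

-- Fits x ps says that ps is weakly decreasing with entries at most x, and that
-- the cars ps can fill the street when it has length ps spots left.
Fits : ∀ {n m} → ℕ → Vec (Fin n) m → Set
Fits x []                 = ⊤
Fits {m = suc m} x (p ∷ ps) = toℕ p ≤ x × toℕ p ≤ m × Fits (toℕ p) ps

fits-weaken : ∀ {n m x y} → x ≤ y → (ps : Vec (Fin n) m) → Fits x ps → Fits y ps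
fits-weaken x≤y []       _           = tt
fits-weaken x≤y (p ∷ ps) (p≤x , fit) = ℕ.≤-trans p≤x x≤y , fit

-- The first of `suc m` cars prefers a spot at most `m`, so a bound above `m` does not restrict it.
fits-strengthen : ∀ {n m x} (ps : Vec (Fin n) (suc m)) → m ≤ x → Fits (suc x) ps → Fits x ps
fits-strengthen (p ∷ ps) m≤x (_ , p≤m , fit) = ℕ.≤-trans p≤m m≤x , p≤m , fit

fits-bound : ∀ {n m x s} {ps : Vec (Fin n) m} → Fits x ps → s ∈ᵛ ps → toℕ s ≤ x
fits-bound {ps = p ∷ ps} (p≤x , _ , fit) (here refl)  = p≤x
fits-bound {ps = p ∷ ps} (p≤x , _ , fit) (there s∈ps) = ℕ.≤-trans (fits-bound fit s∈ps) p≤x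

fits-bound-length : ∀ {n m x s} {ps : Vec (Fin n) m} → Fits x ps → s ∈ᵛ ps → toℕ s < m
fits-bound-length {ps = p ∷ ps} (_ , p≤m , fit) (here refl)  = s≤s p≤m
fits-bound-length {ps = p ∷ ps} (_ , _ , fit)   (there s∈ps) = ℕ.m<n⇒m<1+n (fits-bound-length fit s∈ps)

-- The down-step: a car preferring the current spot `x` enters. With `suc m` cars left, `x ≤ m` says
-- that the height is positive. The property `P` is arbitrary so that each of the counts below can
-- use the same step lemmas.
hasSize-head : ∀ {n m x N} {P : Vec (Fin n) (suc m) → Set} (x<n : x < n) → x ≤ m →
  (λ ps → Fits x ps × P (fromℕ< x<n ∷ ps)) HasSize N →
  (λ ps → (∃[ qs ] ps ≡ fromℕ< x<n ∷ qs) × Fits x ps × P ps) HasSize N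
hasSize-head {x = x} {P = P} x<n x≤m size =
  hasSize-⇔ (λ ps → mk⇔ fwd bwd) (hasSize-map (fromℕ< x<n ∷_) Vec.∷-injectiveʳ size)
  where
  x≡ : toℕ (fromℕ< x<n) ≡ x
  x≡ = Fin.toℕ-fromℕ< x<n
  fwd : ∀ {ps} → ∃[ qs ] (Fits x qs × P (fromℕ< x<n ∷ qs)) × ps ≡ fromℕ< x<n ∷ qs →
        (∃[ qs ] ps ≡ fromℕ< x<n ∷ qs) × Fits x ps × P ps
  fwd (qs , (fit , Pqs) , refl) =
    (qs , refl) , (ℕ.≤-reflexive x≡ , subst (_≤ _) (sym x≡) x≤m , subst (λ y → Fits y qs) (sym x≡) fit) , Pqs
  bwd : ∀ {ps} → (∃[ qs ] ps ≡ fromℕ< x<n ∷ qs) × Fits x ps × P ps →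
        ∃[ qs ] (Fits x qs × P (fromℕ< x<n ∷ qs)) × ps ≡ fromℕ< x<n ∷ qs
  bwd ((qs , refl) , (_ , _ , fit) , Pps) = qs , (subst (λ y → Fits y qs) x≡ fit , Pps) , refl

-- Conditioning on the first step at positive height: `below` lowers the current spot from `suc x`
-- to `x`, and `at` sends in a car preferring `suc x`.
hasSize-step : ∀ {n m x M N} {P : Vec (Fin n) (suc m) → Set} (x<n : suc x < n) → suc x ≤ m →
  (λ ps → Fits x ps × P ps) HasSize M →
  (λ ps → Fits (suc x) ps × P (fromℕ< x<n ∷ ps)) HasSize N →
  (λ ps → Fits (suc x) ps × P ps) HasSize (M + N)
hasSize-step {x = x} {P = P} x<n x≤m below at =
  hasSize-⇔ (λ ps → mk⇔ (merge ps) (split ps))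
            (hasSize-⊎ disjoint below (hasSize-head {P = P} x<n x≤m at))
  where
  x≡ : toℕ (fromℕ< x<n) ≡ suc x
  x≡ = Fin.toℕ-fromℕ< x<n
  At : Vec _ _ → Set
  At ps = (∃[ qs ] ps ≡ fromℕ< x<n ∷ qs) × Fits (suc x) ps × P ps
  disjoint : ∀ {ps} → Fits x ps × P ps → ¬ At ps
  disjoint ((p≤x , _) , _) ((qs , refl) , _) = ℕ.<-irrefl x≡ (s≤s p≤x)
  merge : ∀ ps → (Fits x ps × P ps) ⊎ At ps → Fits (suc x) ps × P ps
  merge ps (inj₁ (fit , Pps)) = fits-weaken (ℕ.n≤1+n x) ps fit , Pps
  merge ps (inj₂ (_ , rest))  = rest
  split : ∀ ps → Fits (suc x) ps × P ps → (Fits x ps × P ps) ⊎ At ps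
  split (p ∷ ps) (fit@(p≤ , p≤m , fit′) , Pps) with ℕ.m≤n⇒m<n∨m≡n p≤
  ... | inj₁ (s≤s p≤x) = inj₁ ((p≤x , p≤m , fit′) , Pps)
  ... | inj₂ p≡        = inj₂ ((ps , cong (_∷ ps) (Fin.toℕ-injective (trans p≡ (sym x≡)))) , fit , Pps)

-- Without positive height no car may prefer the current spot `suc x`, so the first step is up.
hasSize-level : ∀ {n m x N} {P : Vec (Fin n) (suc m) → Set} → m ≤ x →
  (λ ps → Fits x ps × P ps) HasSize N → (λ ps → Fits (suc x) ps × P ps) HasSize N
hasSize-level m≤x = hasSize-⇔ λ ps → mk⇔ (λ (fit , Pps) → fits-weaken (ℕ.n≤1+n _) ps fit , Pps)
                                         (λ (fit , Pps) → fits-strengthen ps m≤x fit , Pps)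

-- The height is the number of cars left minus the current spot, whence `m ≡ d + x`. Lowering the
-- spot raises it by one; sending in a car lowers it by one.
fits-count : ∀ {n m} x d → m ≡ d + x → m ≤ n → (λ (ps : Vec (Fin n) m) → Fits x ps × ⊤) HasSize ballot x d
fits-count zero    zero    refl _ =
  hasSize-⇔ (λ { [] → mk⇔ _ (λ _ → refl) }) (hasSize-singleton [])
fits-count zero    (suc d) refl d<n =
  hasSize-⇔ (λ ps → mk⇔ proj₂ (λ F → zeroHead ps F , F))
    (hasSize-head {P = λ _ → ⊤} 0<n z≤n (fits-count zero d refl (ℕ.<⇒≤ d<n)))
  where
  0<n = ℕ.<-≤-trans (s≤s z≤n) d<n
  zeroHead : ∀ ps → Fits 0 ps × ⊤ → ∃[ qs ] ps ≡ fromℕ< 0<n ∷ qs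
  zeroHead (p ∷ ps) ((p≤0 , _) , _) =
    ps , cong (_∷ ps) (Fin.toℕ-injective (trans (ℕ.n≤0⇒n≡0 p≤0) (sym (Fin.toℕ-fromℕ< 0<n))))
fits-count (suc x) zero    refl m≤n = hasSize-level ℕ.≤-refl (fits-count x 1 refl m≤n)
fits-count (suc x) (suc d) refl m≤n =
  hasSize-step {P = λ _ → ⊤} (ℕ.≤-trans (s≤s (ℕ.m≤n+m (suc x) d)) m≤n) (ℕ.m≤n+m (suc x) d)
    (fits-count x (suc (suc d)) (cong suc (ℕ.+-suc d x)) m≤n)
    (fits-count (suc x) d refl (ℕ.<⇒≤ m≤n))

-- Sequences in which a given spot occurs

-- Counts the paths from height `d` whose first step is down; there are none at height 0.
ballot⁻ : ℕ → ℕ → ℕ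
ballot⁻ p zero    = 0
ballot⁻ p (suc d) = ballot p d

ballot-ballot⁻ : ∀ p d → ballot (suc p) d ≡ ballot p (suc d) + ballot⁻ (suc p) d
ballot-ballot⁻ p zero    = sym (ℕ.+-identityʳ _)
ballot-ballot⁻ p (suc d) = refl

-- Here `u` up-steps remain until `s` is the current spot. At `u = 0` only `ballot⁻` is left: the
-- next step must be down. The convolution corrects the recurrence of `ballot⁻` at height 0.
occursSize : ℕ → ℕ → ℕ → ℕ
occursSize s u d = conv (λ k → ballot (k + s) 0) u d + ballot⁻ (u + s) d

-- The `ballot⁻` term vanishes on the left and is `ballot (u + s) 0` on the right, which is exactly
-- the boundary term of `conv-0`.
occursSize-0 : ∀ s u → occursSize s (suc u) 0 ≡ occursSize s u 1
occursSize-0 s u = trans (ℕ.+-identityʳ _) (conv-0 (λ k → ballot (k + s) 0) u)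

occursSize-suc : ∀ s u d → occursSize s (suc u) (suc d) ≡ occursSize s u (suc (suc d)) + occursSize s (suc u) d
occursSize-suc s u d =
  trans (cong₂ _+_ (conv-suc (λ k → ballot (k + s) 0) u d) (ballot-ballot⁻ (u + s) d))
        (interchange (conv g u (suc (suc d))) (conv g (suc u) d) (ballot (u + s) (suc d)) (ballot⁻ (suc u + s) d))
  where
  g = λ k → ballot (k + s) 0

occurs-count : ∀ {n m} (s : Fin n) u d → m ≡ d + (u + toℕ s) → m ≤ n →
  (λ (ps : Vec (Fin n) m) → Fits (u + toℕ s) ps × s ∈ᵛ ps) HasSize occursSize (toℕ s) u d
occurs-count s zero    zero    m≡ m≤n =
  -- Only `toℕ s` cars are left, and every entry is below the number of cars left.
  hasSize-∅ λ ps (fit , s∈ps) → ℕ.<-irrefl (sym m≡) (fits-bound-length fit s∈ps)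
occurs-count s zero    (suc d) refl m≤n =
  hasSize-⇔ (λ ps → mk⇔ occurs (isHead ps))
    (hasSize-head {P = λ _ → ⊤} (Fin.toℕ<n s) (ℕ.m≤n+m (toℕ s) d) (fits-count (toℕ s) d refl (ℕ.<⇒≤ m≤n)))
  where
  s≡ = Fin.fromℕ<-toℕ s (Fin.toℕ<n s)
  occurs : ∀ {ps} → (∃[ qs ] ps ≡ fromℕ< (Fin.toℕ<n s) ∷ qs) × Fits (toℕ s) ps × ⊤ → Fits (toℕ s) ps × s ∈ᵛ ps
  occurs ((qs , refl) , fit , _) = fit , here (sym s≡)
  -- Later entries are no larger than the head and the head is at most `s`, so an occurrence of `s`
  -- anywhere forces the head to be `s`.
  isHead : ∀ ps → Fits (toℕ s) ps × s ∈ᵛ ps → (∃[ qs ] ps ≡ fromℕ< (Fin.toℕ<n s) ∷ qs) × Fits (toℕ s) ps × ⊤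
  isHead (p ∷ ps) (fit , here refl)                 = (ps , cong (_∷ ps) (sym s≡)) , fit , tt
  isHead (p ∷ ps) (fit@(p≤s , _ , fit′) , there s∈) =
    (ps , cong (_∷ ps) (trans (Fin.toℕ-injective (ℕ.≤-antisym p≤s (fits-bound fit′ s∈))) (sym s≡))) , fit , tt
occurs-count s (suc u) zero    refl m≤n =
  hasSize-≡ (sym (occursSize-0 (toℕ s) u)) (hasSize-level ℕ.≤-refl (occurs-count s u 1 refl m≤n))
occurs-count s (suc u) (suc d) refl m≤n =
  hasSize-≡ (sym (occursSize-suc (toℕ s) u d))
    (hasSize-step x<n (ℕ.m≤n+m _ d)
      (occurs-count s u (suc (suc d)) (cong suc (ℕ.+-suc d (u + toℕ s))) m≤n)
      (hasSize-⇔ (λ ps → mk⇔ (map₂ there) (map₂ notHead))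
        (occurs-count s (suc u) d refl (ℕ.<⇒≤ m≤n))))
  where
  x<n = ℕ.≤-trans (s≤s (ℕ.m≤n+m (suc u + toℕ s) d)) m≤n
  notHead : ∀ {ps} → s ∈ᵛ fromℕ< x<n ∷ ps → s ∈ᵛ ps
  notHead (there s∈ps) = s∈ps
  notHead (here s≡)    =
    contradiction (trans (cong toℕ s≡) (Fin.toℕ-fromℕ< x<n)) (ℕ.<⇒≢ (s≤s (ℕ.m≤n+m (toℕ s) u)))

-- Sequences with a descent at a given car

-- The bound `x` acts as the preference preceding the first entry, so the first car needs no
-- separate notion of descent.
Descends : ∀ {n m} → ℕ → Vec (Fin n) m → Fin m → Set
Descends x (p ∷ ps) zero    = toℕ p < x
Descends x (p ∷ ps) (suc i) = Descends (toℕ p) ps i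

descends-suc : ∀ {n m} x y (ps : Vec (Fin n) (suc m)) {i : Fin m} → Descends x ps (suc i) → Descends y ps (suc i)
descends-suc x y (p ∷ ps) desc = desc

fits-0-¬descends : ∀ {n m x} (ps : Vec (Fin n) m) i → x ≡ 0 → Fits x ps → ¬ Descends x ps i
fits-0-¬descends (p ∷ ps) zero    refl _               ()
fits-0-¬descends (p ∷ ps) (suc i) refl (p≤0 , _ , fit) = fits-0-¬descends ps i (ℕ.n≤0⇒n≡0 p≤0) fit

-- The cutoff is the number of cars after car `i`. An up-step changes neither `m` nor `i` and a
-- down-step lowers both, so the weight stays fixed along the recurrence. At `i = 0` the first step
-- must be up.
descends-count : ∀ {n m} x d (i : Fin m) → m ≡ d + x → m ≤ n →
  (λ (ps : Vec (Fin n) m) → Fits x ps × Descends x ps i)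
    HasSize conv (truncate (m ∸ suc (toℕ i)) λ k → ballot k 0) x d
descends-count zero    d i m≡ m≤n = hasSize-∅ λ ps (fit , desc) → fits-0-¬descends ps i refl fit desc
descends-count {m = suc m} (suc x) d zero m≡ m≤n =
  hasSize-≡ (sym size≡) (hasSize-⇔ equiv (fits-count x (suc d) m≡′ m≤n))
  where
  m≡′ : suc m ≡ suc d + x
  m≡′ = trans m≡ (ℕ.+-suc d x)
  size≡ : conv (truncate m λ k → ballot k 0) (suc x) d ≡ ballot x (suc d)
  -- All indices satisfy `k ≤ x ≤ m`, so the cutoff removes nothing and `conv-catalan` applies.
  size≡ = trans
    (conv-cong (suc x) d λ k k≤x → truncate-≤ {m} (λ k → ballot k 0)
      (ℕ.≤-trans (ℕ.≤-pred k≤x) (ℕ.≤-trans (ℕ.m≤n+m x d) (ℕ.≤-reflexive (sym (ℕ.suc-injective m≡′))))))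
    (conv-catalan x d)
  equiv : ∀ ps → (Fits x ps × ⊤) ⇔ (Fits (suc x) ps × Descends (suc x) ps zero)
  equiv (p ∷ ps) = mk⇔ (λ (fit@(p≤x , _) , _) → fits-weaken (ℕ.n≤1+n x) (p ∷ ps) fit , s≤s p≤x)
                       (λ ((_ , fit) , p<x) → (ℕ.≤-pred p<x , fit) , tt)
descends-count (suc x) zero (suc i) refl m≤n =
  hasSize-≡ (sym size≡)
    (hasSize-level ℕ.≤-refl (hasSize-⇔ (λ ps → mk⇔ (map₂ (descends-suc x (suc x) ps)) (map₂ (descends-suc (suc x) x ps)))
      (descends-count x 1 (suc i) refl m≤n)))
  where
  c = truncate (x ∸ suc (toℕ i)) λ k → ballot k 0
  size≡ : conv c (suc x) 0 ≡ conv c x 1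
  -- The boundary term has index `x`, beyond the cutoff `x ∸ suc (toℕ i)`, and vanishes.
  size≡ = trans (conv-0 c x)
    (trans (cong (conv c x 1 +_) (truncate-> (λ k → ballot k 0) (ℕ.∸-monoʳ-< {x} {suc (toℕ i)} {0} (s≤s z≤n) (Fin.toℕ<n i)))) (ℕ.+-identityʳ _))
descends-count (suc x) (suc d) (suc i) refl m≤n =
  hasSize-≡ (sym (conv-suc _ x d))
    (hasSize-step x<n (ℕ.m≤n+m (suc x) d)
      (hasSize-⇔ (λ ps → mk⇔ (map₂ (descends-suc x (suc x) ps)) (map₂ (descends-suc (suc x) x ps)))
        (descends-count x (suc (suc d)) (suc i) (cong suc (ℕ.+-suc d x)) m≤n))
      (hasSize-⇔ (λ ps → mk⇔ (map₂ (subst (λ y → Descends y ps i) (sym x≡))) (map₂ (subst (λ y → Descends y ps i) x≡)))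
        (descends-count (suc x) d i refl (ℕ.<⇒≤ m≤n))))
  where
  x<n = ℕ.≤-trans (s≤s (ℕ.m≤n+m (suc x) d)) m≤n
  x≡ = Fin.toℕ-fromℕ< x<n

-- The parking process

find-satisfies : ∀ {A : Set} {P : A → Set} (P? : Decidable P) xs {x} → find P? xs ≡ just x → P x
find-satisfies P? (y ∷ ys) eq with P? y | eq
... | yes Py | refl = Py
... | no  _  | eq′  = find-satisfies P? ys eq′

find-nothing : ∀ {A : Set} {P : A → Set} (P? : Decidable P) {xs x} → find P? xs ≡ nothing → x ∈ xs → ¬ P x
find-nothing P? {y ∷ ys} eq x∈ Px with P? y | eq | x∈
... | yes _  | ()  | _
... | no ¬Py | eq′ | here refl = ¬Py Px
... | no ¬Py | eq′ | there x∈′ = find-nothing P? eq′ x∈′ Px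

find-first : ∀ {A : Set} {P : A → Set} {R : A → A → Set} (P? : Decidable P) {xs x} → AllPairs R xs →
             x ∈ xs → P x → (∀ {y} → R y x → ¬ P y) → find P? xs ≡ just x
find-first P? {y ∷ ys} (y~ys ∷ ys!) x∈ Px before with P? y | x∈
... | yes _  | here refl = refl
... | yes Py | there x∈′ = contradiction Py (before (All.lookup y~ys x∈′))
... | no ¬Py | here refl = contradiction Px ¬Py
... | no ¬Py | there x∈′ = find-first P? ys! x∈′ Px before

firstAvailable-just : ∀ {n} {O : Subset n} {p s} → firstAvailable O p ≡ just s → toℕ p ≤ toℕ s × s ∉ˢ O
firstAvailable-just {n} = find-satisfies _ (allFin n)

firstAvailable-nothing : ∀ {n} {O : Subset n} {p} → firstAvailable O p ≡ nothing → ∀ {s} → toℕ p ≤ toℕ s → s ∈ˢ O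
firstAvailable-nothing {O = O} eq {s} p≤s =
  decidable-stable (s Subset.∈? O) λ s∉O → find-nothing _ eq (∈-allFin s) (p≤s , s∉O)

firstAvailable-free : ∀ {n} {O : Subset n} {p} → p ∉ˢ O → firstAvailable O p ≡ just p
firstAvailable-free {p = p} p∉O =
  find-first _ (AllPairs.tabulate⁺-< id) (∈-allFin p) (ℕ.≤-refl , p∉O) λ y<p (p≤y , _) → ℕ.<⇒≱ y<p p≤y

∣p∪⁅x⁆∣ : ∀ {n} {O : Subset n} {s} → s ∉ˢ O → ∣ O ∪ ⁅ s ⁆ ∣ ≡ suc ∣ O ∣
∣p∪⁅x⁆∣ {O = outside ∷ O} {zero}  s∉O = cong (suc ∘ ∣_∣) (Subset.∪-identityʳ O)
∣p∪⁅x⁆∣ {O = inside  ∷ O} {zero}  s∉O = contradiction here s∉O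
∣p∪⁅x⁆∣ {O = outside ∷ O} {suc s} s∉O = ∣p∪⁅x⁆∣ (s∉O ∘ there)
∣p∪⁅x⁆∣ {O = inside  ∷ O} {suc s} s∉O = cong suc (∣p∪⁅x⁆∣ (s∉O ∘ there))

upFrom : ∀ {n} → ℕ → Subset n
upFrom         zero    = Subset.⊤
upFrom {zero}  (suc q) = []
upFrom {suc n} (suc q) = outside ∷ upFrom q

∣upFrom∣ : ∀ n q → ∣ upFrom {n} q ∣ ≡ n ∸ q
∣upFrom∣ n       zero    = Subset.∣⊤∣≡n n
∣upFrom∣ zero    (suc q) = refl
∣upFrom∣ (suc n) (suc q) = ∣upFrom∣ n q

∈-upFrom⁺ : ∀ {n} q {s : Fin n} → q ≤ toℕ s → s ∈ˢ upFrom q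
∈-upFrom⁺ zero    _                 = Subset.∈⊤
∈-upFrom⁺ (suc q) {suc s} (s≤s q≤s) = there (∈-upFrom⁺ q q≤s)

∈-upFrom⁻ : ∀ {n} q {s : Fin n} → s ∈ˢ upFrom q → q ≤ toℕ s
∈-upFrom⁻ zero    _          = z≤n
∈-upFrom⁻ (suc q) {suc s} (there s∈) = s≤s (∈-upFrom⁻ q s∈)

-- Invariant of parking in weakly decreasing order, with `x` the latest preference. Before the first
-- car `x` is `n`, one past the last spot, where `at` is vacuous.
record Occupied {n} (x : ℕ) (O : Subset n) : Set where
  field
    above : ∀ {s} → s ∈ˢ O → x ≤ toℕ s
    at    : ∀ {s} → toℕ s ≡ x → s ∈ˢ O

open Occupied

occupied-∅ : ∀ n → Occupied n (Subset.⊥ {n})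
occupied-∅ n .above s∈ = contradiction s∈ Subset.∉⊥
occupied-∅ n .at {s} s≡n = contradiction s≡n (ℕ.<⇒≢ (Fin.toℕ<n s))

-- A car never parks before its preference `p`, and it either takes `p` or finds it taken; the
-- latter covers a car that fails to park.
occupied-step : ∀ {n x} {O : Subset n} {p} → Occupied x O → toℕ p ≤ x →
                Occupied (toℕ p) (occupy (firstAvailable O p) O)
occupied-step {O = O} {p} occ p≤x .above s∈ with firstAvailable O p in eq
... | nothing = ℕ.≤-trans p≤x (above occ s∈)
... | just t with Subset.x∈p∪q⁻ O ⁅ t ⁆ s∈
...   | inj₁ s∈O  = ℕ.≤-trans p≤x (above occ s∈O)
...   | inj₂ s∈⁅t⁆ with refl ← Subset.x∈⁅y⁆⇒x≡y t s∈⁅t⁆ = proj₁ (firstAvailable-just {O = O} eq)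
occupied-step {O = O} {p} occ p≤x .at {s} s≡p with refl ← Fin.toℕ-injective s≡p | p Subset.∈? O
... | no p∉O rewrite firstAvailable-free p∉O = Subset.q⊆p∪q O ⁅ p ⁆ (Subset.x∈⁅x⁆ p)
... | yes p∈O with firstAvailable O p
...   | nothing = p∈O
...   | just t  = Subset.p⊆p∪q ⁅ t ⁆ p∈O

-- All occupied spots lie at or after `p`, and `s` is a further such spot that is free; hence
-- `∣ O ∣ = n - (m + 1)` is less than `n - p`.
firstAvailable-just⇒room : ∀ {n m x s} {O : Subset n} {p} → Occupied x O → ∣ O ∣ + suc m ≡ n → toℕ p ≤ x →
                           firstAvailable O p ≡ just s → toℕ p ≤ m
firstAvailable-just⇒room {n} {m} {x} {s} {O} {p} occ size p≤x eq = ℕ.≮⇒≥ λ m<p → ℕ.<⇒≱ O<room (begin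
  n ∸ toℕ p               ≤⟨ ℕ.∸-monoʳ-≤ n m<p ⟩
  n ∸ suc m               ≡⟨ cong (_∸ suc m) size ⟨
  ∣ O ∣ + suc m ∸ suc m   ≡⟨ ℕ.m+n∸n≡m ∣ O ∣ (suc m) ⟩
  ∣ O ∣                   ∎)
  where
  open ℕ.≤-Reasoning
  s-free = firstAvailable-just {O = O} eq
  O<room : ∣ O ∣ < n ∸ toℕ p
  O<room = subst (∣ O ∣ <_) (∣upFrom∣ n (toℕ p)) (Subset.p⊂q⇒∣p∣<∣q∣
    ((λ t∈O → ∈-upFrom⁺ (toℕ p) (ℕ.≤-trans p≤x (above occ t∈O))) ,
     s , ∈-upFrom⁺ (toℕ p) (proj₁ s-free) , proj₂ s-free))

-- A failed search would mean that all `n - p` spots from `p` on are taken, but only `n - (m + 1)`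
-- spots are.
room⇒firstAvailable≢nothing : ∀ {n m} {O : Subset n} {p} → ∣ O ∣ + suc m ≡ n → toℕ p ≤ m →
                              firstAvailable O p ≢ nothing
room⇒firstAvailable≢nothing {n} {m} {O} {p} size p≤m eq = ℕ.<⇒≱ (ℕ.n<1+n ∣ O ∣) (begin
  suc ∣ O ∣              ≡⟨ ℕ.m+n∸n≡m (suc ∣ O ∣) m ⟨
  suc ∣ O ∣ + m ∸ m      ≡⟨ cong (_∸ m) (trans (sym (ℕ.+-suc ∣ O ∣ m)) size) ⟩
  n ∸ m                  ≤⟨ ℕ.∸-monoʳ-≤ n p≤m ⟩
  n ∸ toℕ p              ≡⟨ ∣upFrom∣ n (toℕ p) ⟨
  ∣ upFrom {n} (toℕ p) ∣ ≤⟨ Subset.p⊆q⇒∣p∣≤∣q∣ (λ s∈ → firstAvailable-nothing eq (∈-upFrom⁻ (toℕ p) s∈)) ⟩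
  ∣ O ∣                  ∎)
  where open ℕ.≤-Reasoning

occupy-size : ∀ {n m s} {O : Subset n} {p} → firstAvailable O p ≡ just s → ∣ O ∣ + suc m ≡ n →
              ∣ occupy (firstAvailable O p) O ∣ + m ≡ n
occupy-size {m = m} {O = O} eq size rewrite eq =
  trans (cong (_+ m) (∣p∪⁅x⁆∣ (proj₂ (firstAvailable-just {O = O} eq)))) (trans (sym (ℕ.+-suc ∣ O ∣ m)) size)

-- Weakly decreasing parking functions as fitting sequences

fits⇒linked : ∀ {n m x} (ps : Vec (Fin n) m) → Fits x ps → Linked Fin._≥_ ps
fits⇒linked []           _             = []
fits⇒linked (p ∷ [])     _             = [-]
fits⇒linked (p ∷ q ∷ ps) (_ , _ , fit) = proj₁ fit ∷ fits⇒linked (q ∷ ps) fit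

fits⇒park : ∀ {n m x} {O : Subset n} (ps : Vec (Fin n) m) → Occupied x O → ∣ O ∣ + m ≡ n → Fits x ps →
            ∀ i → Is-just (lookup (park O ps) i)
fits⇒park {O = O} (p ∷ ps) occ size (p≤x , p≤m , fit) i with firstAvailable O p in eq | i
... | nothing | _     = contradiction eq (room⇒firstAvailable≢nothing size p≤m)
... | just s  | zero  = Maybe.just tt
... | just s  | suc i =
  subst (λ f → ∀ i → Is-just (lookup (park (occupy f O) ps) i)) eq
    (fits⇒park ps (occupied-step occ p≤x) (occupy-size eq size) fit) i

park⇒fits : ∀ {n m x} {O : Subset n} {p} (ps : Vec (Fin n) m) → Occupied x O → ∣ O ∣ + suc m ≡ n →
            toℕ p ≤ x → Linked Fin._≥_ (p ∷ ps) → (∀ i → Is-just (lookup (park O (p ∷ ps)) i)) → Fits x (p ∷ ps)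
park⇒fits {O = O} {p} ps occ size p≤x linked parked with firstAvailable O p in eq
... | nothing with () ← parked zero
... | just s  = p≤x , firstAvailable-just⇒room occ size p≤x eq , rest ps linked size parked
  where
  rest : ∀ {m} (ps : Vec _ m) → Linked Fin._≥_ (p ∷ ps) → ∣ O ∣ + suc m ≡ _ →
         (∀ i → Is-just (lookup (just s ∷ park (occupy (just s) O) ps) i)) → Fits (toℕ p) ps
  rest []       _              _    _      = tt
  rest (q ∷ qs) (p≥q ∷ linked) size parked =
    park⇒fits qs (subst (λ f → Occupied (toℕ p) (occupy f O)) eq (occupied-step occ p≤x))
      (subst (λ f → ∣ occupy f O ∣ + suc _ ≡ _) eq (occupy-size eq size)) p≥q linked (parked ∘ suc)

decreasing-parking⇔fits : ∀ {n} (a : Preferences n) → (IsWeaklyDecreasing a × IsParkingFunction a) ⇔ Fits n a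
decreasing-parking⇔fits {n} a = mk⇔ (fwd a refl) λ fit →
  fits⇒linked a fit , fits⇒park a (occupied-∅ n) (cong (_+ n) (Subset.∣⊥∣≡0 n)) fit
  where
  fwd : ∀ {m} (a : Vec (Fin n) m) → m ≡ n →
        Linked Fin._≥_ a × (∀ i → Is-just (lookup (park Subset.⊥ a) i)) → Fits n a
  fwd []      _    _                 = tt
  fwd (p ∷ a) refl (linked , parked) =
    park⇒fits a (occupied-∅ n) (cong (_+ n) (Subset.∣⊥∣≡0 n)) (ℕ.<⇒≤ (Fin.toℕ<n p)) linked parked

-- Lucky spots and lucky cars

-- The first car preferring `s` is lucky: the cars before it prefer spots beyond `s` and park no
-- earlier than they prefer, so `s` is still free.
∈⇒luckySpot : ∀ {n m x s} {O : Subset n} {ps : Vec (Fin n) m} → s ∉ˢ O → Fits x ps → s ∈ᵛ ps →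
              ∃[ i ] lookup (park O ps) i ≡ just s × lookup ps i ≡ s
∈⇒luckySpot                      s∉O _ (here refl) = zero , firstAvailable-free s∉O , refl
∈⇒luckySpot {s = s} {O} {p ∷ ps} s∉O (p≤x , p≤m , fit) (there s∈ps) with s Fin.≟ p
... | yes refl = zero , firstAvailable-free s∉O , refl
... | no s≢p   = let i , rest = ∈⇒luckySpot s∉O′ fit s∈ps in suc i , rest
  where
  s∉O′ : s ∉ˢ occupy (firstAvailable O p) O
  s∉O′ s∈ with firstAvailable O p in eq
  ... | nothing = s∉O s∈
  ... | just t with Subset.x∈p∪q⁻ O ⁅ t ⁆ s∈
  ...   | inj₁ s∈O   = s∉O s∈O
  ...   | inj₂ s∈⁅t⁆ with refl ← Subset.x∈⁅y⁆⇒x≡y t s∈⁅t⁆ =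
    s≢p (Fin.toℕ-injective (ℕ.≤-antisym (fits-bound fit s∈ps) (proj₁ (firstAvailable-just {O = O} eq))))

luckySpot⇔∈ : ∀ {n x} {s : Fin n} {a : Preferences n} → Fits x a → LuckySpot s a ⇔ s ∈ᵛ a
luckySpot⇔∈ {a = a} fit = mk⇔ (λ { (i , _ , refl) → ∈-lookup i a }) (∈⇒luckySpot Subset.∉⊥ fit)

-- By the invariant, a preference equal to the previous one is already taken, while one strictly
-- below it lies before every occupied spot.
luckyCar⇔descends : ∀ {n m x} {O : Subset n} {ps : Vec (Fin n) m} i → Occupied x O → Fits x ps →
                    lookup (park O ps) i ≡ just (lookup ps i) ⇔ Descends x ps i
luckyCar⇔descends {x = x} {O} {p ∷ ps} zero occ (p≤x , _) = mk⇔
  (λ eq → ℕ.≤∧≢⇒< p≤x λ p≡x → proj₂ (firstAvailable-just {O = O} eq) (at occ p≡x))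
  (λ p<x → firstAvailable-free λ p∈O → ℕ.<⇒≱ p<x (above occ p∈O))
luckyCar⇔descends {ps = p ∷ ps} (suc i) occ (p≤x , _ , fit) = luckyCar⇔descends i (occupied-step occ p≤x) fit

-- Evaluation of the counts and conclusion

catalanSum : ∀ {n} → Fin n → ℚ
catalanSum {n} j = ∑[ k ≤ n ∸ label j ] (catalan (n ∸ 1 ∸ toℕ k) * catalan (toℕ k))

conv-catalanSum : ∀ {n} (j : Fin n) →
  ℕ→ℚ (conv (truncate (n ∸ label j) λ k → ballot k 0) n 0) ≡ catalanSum j
conv-catalanSum {n} j =
  trans (conv-truncate-∑ (n ∸ label j) (λ k → ballot k 0) n 0 (ℕ.∸-monoʳ-< {n} {label j} {0} (s≤s z≤n) (Fin.toℕ<n j)))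
        (sum-cong-≗ {suc (n ∸ label j)} λ k → cong₂ _*_
          (trans (cong (λ m → ℕ→ℚ (ballot m 0)) (sym (ℕ.∸-+-assoc n 1 (toℕ k)))) (sym (catalan≡ballot (n ∸ 1 ∸ toℕ k))))
          (sym (catalan≡ballot (toℕ k))))

-- The convolution has terms `ballot (r ∸ k) 0` times `ballot (k + toℕ j) 0` with
-- `r + toℕ j ≡ n ∸ 1`; replacing `k` by `r ∸ k` gives the required Catalan product.
occursSize-catalanSum : ∀ {n} (j : Fin n) →
  ℕ→ℚ (occursSize (toℕ j) (suc (n ∸ label j)) 0) ≡ catalanSum j
occursSize-catalanSum {n} j = begin
  ℕ→ℚ (conv g (suc r) 0 + 0)
    -- The convolution has exactly the indices `k ≤ r`, so inserting the cutoff `r` changes nothing.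
    ≡⟨ cong ℕ→ℚ (trans (ℕ.+-identityʳ _) (conv-cong (suc r) 0 λ k k≤r → sym (truncate-≤ g (ℕ.≤-pred k≤r)))) ⟩
  ℕ→ℚ (conv (truncate r g) (suc r) 0)
    ≡⟨ conv-truncate-∑ r g (suc r) 0 (ℕ.n<1+n r) ⟩
  ∑[ k ≤ r ] f (toℕ k)
    ≡⟨ ∑-reverse (suc r) f ⟩
  ∑[ k ≤ r ] f (r ∸ toℕ k)
    ≡⟨ sum-cong-≗ {suc r} (λ k → summand (toℕ k) (ℕ.≤-pred (Fin.toℕ<n k))) ⟩
  catalanSum j
    ∎
  where
  open ≡-Reasoning
  r = n ∸ label j
  g = λ k → ballot (k + toℕ j) 0
  f = λ k → ℕ→ℚ (ballot (r ∸ k) 0) * ℕ→ℚ (g k)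
  r+j≡ : r + toℕ j ≡ n ∸ 1
  r+j≡ = cong (_∸ 1) (trans (sym (ℕ.+-suc r (toℕ j))) (ℕ.m∸n+n≡m (Fin.toℕ<n j)))
  summand : ∀ k → k ≤ r → f (r ∸ k) ≡ catalan (n ∸ 1 ∸ k) * catalan k
  summand k k≤r = begin
    ℕ→ℚ (ballot (r ∸ (r ∸ k)) 0) * ℕ→ℚ (ballot (r ∸ k + toℕ j) 0)
      ≡⟨ cong₂ (λ a b → ℕ→ℚ (ballot a 0) * ℕ→ℚ (ballot b 0)) (ℕ.m∸[m∸n]≡n k≤r)
           (trans (sym (ℕ.+-∸-comm (toℕ j) k≤r)) (cong (_∸ k) r+j≡)) ⟩
    ℕ→ℚ (ballot k 0) * ℕ→ℚ (ballot (n ∸ 1 ∸ k) 0)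
      ≡⟨ cong₂ _*_ (catalan≡ballot k) (catalan≡ballot (n ∸ 1 ∸ k)) ⟨
    catalan k * catalan (n ∸ 1 ∸ k)
      ≡⟨ ℚ.*-comm (catalan k) (catalan (n ∸ 1 ∸ k)) ⟩
    catalan (n ∸ 1 ∸ k) * catalan k
      ∎

hasSize-parking : ∀ {n N} {P Q : Preferences n → Set} → (∀ {a} → Fits n a → P a ⇔ Q a) →
  (λ a → Fits n a × Q a) HasSize N → (λ a → IsWeaklyDecreasing a × IsParkingFunction a × P a) HasSize N
hasSize-parking P⇔Q = hasSize-⇔ λ a → mk⇔
  (λ (fit , Qa) → let dec , parking = from (decreasing-parking⇔fits a) fit in dec , parking , from (P⇔Q fit) Qa)
  (λ (dec , parking , Pa) → let fit = to (decreasing-parking⇔fits a) (dec , parking) in fit , to (P⇔Q fit) Pa)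

theorem4p1 : (n : ℕ) (j : Fin n) →
    (∃[ N ] (λ (a : Preferences n) → IsWeaklyDecreasing a × IsParkingFunction a × LuckySpot j a) HasSize N
    × ℕ→ℚ N ≡ ∑[ k ≤ n ∸ label j ] (catalan (n ∸ 1 ∸ toℕ k) * catalan (toℕ k)))
    × (∃[ N ] (λ (a : Preferences n) → IsWeaklyDecreasing a × IsParkingFunction a × LuckyCar j a) HasSize N
    × ℕ→ℚ N ≡ ∑[ k ≤ n ∸ label j ] (catalan (n ∸ 1 ∸ toℕ k) * catalan (toℕ k)))
    × ∑[ k ≤ n ∸ label j ] (catalan (n ∸ 1 ∸ toℕ k) * catalan (toℕ k))
    ≡ ∑[ k ≤ n ∸ label j ] (recipDenominator j k * ℕ→ℚ ((2 *ℕ (n ∸ 1 ∸ toℕ k)) C (n ∸ 1 ∸ toℕ k)) * ℕ→ℚ ((2 *ℕ toℕ k) C toℕ k))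
theorem4p1 n j =
  (_ , hasSize-parking {P = LuckySpot j} luckySpot⇔∈ (subst (λ x → (λ (a : Preferences n) → Fits x a × j ∈ᵛ a) HasSize N) x≡n
         -- The path starts at the bound `n`, one past the last spot, so reaching `j` takes
         -- `n - toℕ j` up-steps, that is `suc (n ∸ label j)`.
         (occurs-count j (suc (n ∸ label j)) 0 (sym x≡n) ℕ.≤-refl)) ,
   occursSize-catalanSum j) ,
  (_ , hasSize-parking {P = LuckyCar j} (luckyCar⇔descends j (occupied-∅ n))
         (descends-count n 0 j refl ℕ.≤-refl) ,
   conv-catalanSum j) ,
  sum-cong-≗ {suc (n ∸ label j)} (recip-split j)
  where
  N = occursSize (toℕ j) (suc (n ∸ label j)) 0
  x≡n : suc (n ∸ label j) + toℕ j ≡ n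
  x≡n = trans (sym (ℕ.+-suc (n ∸ label j) (toℕ j))) (ℕ.m∸n+n≡m (Fin.toℕ<n j))
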